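{- The multigraph $(K_3\times K_3)(4)$ has a $(8;p,q)$-decomposition.
   Context: $K_n$ is the complete graph on $n$ vertices; $P_8$ and $C_8$ denote a path and a cycle with $8$ edges. The tensor product $G\times H$ has vertex set $V(G)\times V(H)$, with $(g_1,h_1)(g_2,h_2)$ an edge whenever $g_1g_2\in E(G)$ and $h_1h_2\in E(H)$. For a graph $G$, $G(\lambda)$ is the multigraph obtained by replacing every edge of $G$ by $\lambda$ parallel edges. A (multi)graph $G$ has a $(8;p,q)$-decomposition if, for some nonnegative integers $p,q$ with $8(p+q)=|E(G)|$, the edge set of $G$ can be partitioned into $p$ simple paths isomorphic to $P_8$ and $q$ cycles isomorphic to $C_8$. -}

module Defs where

open import Data.Nat using (ℕ; zero; suc; _+_; _*_; _/_)
open import Data.Bool using (Bool; true; false; not; _∧_; _∨_; if_then_else_)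
open import Data.Fin using (Fin; zero; suc; inject₁; fromℕ)
open import Data.Fin.Properties using () renaming (_≟_ to _≟F_)
open import Data.Product using (Σ; _×_; _,_; proj₁; proj₂)
open import Data.Sum using (_⊎_; inj₁; inj₂)
open import Data.List using (List; []; _∷_; length; filterᵇ; concatMap; map; cartesianProduct; allFin; _++_)
open import Relation.Binary.PropositionalEquality using (_≡_)
open import Relation.Binary.Definitions using (DecidableEquality)
open import Relation.Nullary.Decidable using (⌊_⌋)
open import Function.Definitions using (Injective)

-- A finite simple graph: a vertex type with decidable equality, an explicit
-- complete enumeration of its vertices (without repetitions), and a Boolean
-- adjacency relation (symmetric and loopless in all our instances).
record Graph : Set₁ where
  field
    V     : Set
    _≟V_  : DecidableEquality V
    verts : List V
    adj   : V → V → Bool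

open Graph public

K : ℕ → Graph
K n = record
  { V = Fin n
  ; _≟V_ = _≟F_
  ; verts = allFin n
  ; adj = λ i j → not ⌊ i ≟F j ⌋ }

≟× : {A B : Set} → DecidableEquality A → DecidableEquality B → DecidableEquality (A × B)
≟× dA dB = Data.Product.Properties.≡-dec dA dB
  where import Data.Product.Properties

-- Tensor product G × H : (g1,h1)~(g2,h2) iff g1~g2 in G and h1~h2 in H.
_⊗_ : Graph → Graph → Graph
G ⊗ H = record
  { V = V G × V H
  ; _≟V_ = ≟× (_≟V_ G) (_≟V_ H)
  ; verts = cartesianProduct (verts G) (verts H)
  ; adj = λ x y → adj G (proj₁ x) (proj₁ y) ∧ adj H (proj₂ x) (proj₂ y) }

-- The multigraph G(λ): each edge uv of G replaced by λ parallel edges,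
-- the copies being labelled by Fin λ.  An edge of G(λ) is thus the
-- unordered pair {u,v} (with uv ∈ E(G)) together with a label k : Fin λ.

MEdge : Graph → ℕ → Set
MEdge G λ' = V G × V G × Fin λ'

sameEdge : (G : Graph) (λ' : ℕ) → MEdge G λ' → MEdge G λ' → Bool
sameEdge G λ' (u , v , k) (u' , v' , k') =
  ⌊ k ≟F k' ⌋ ∧ ((eq u u' ∧ eq v v') ∨ (eq u v' ∧ eq v u'))
  where eq = λ a b → ⌊ _≟V_ G a b ⌋

numEdges : Graph → ℕ
numEdges G = length (filterᵇ (λ x → adj G (proj₁ x) (proj₂ x))
                             (cartesianProduct (verts G) (verts G))) / 2

numMEdges : Graph → ℕ → ℕ
numMEdges G λ' = λ' * numEdges G

-- A copy of P_8 (path with 8 edges) in G(λ): 9 distinct vertices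
-- w 0,...,w 8, consecutive ones adjacent in G, and for the i-th edge
-- a choice of parallel copy lab i.
record Path8 (G : Graph) (λ' : ℕ) : Set where
  field
    w      : Fin 9 → V G
    w-inj  : Injective _≡_ _≡_ w
    lab    : Fin 8 → Fin λ'
    w-adj  : ∀ (i : Fin 8) → adj G (w (inject₁ i)) (w (suc i)) ≡ true

record Cycle8 (G : Graph) (λ' : ℕ) : Set where
  field
    w      : Fin 9 → V G
    closed : w (fromℕ 8) ≡ w zero
    w-inj  : Injective _≡_ _≡_ (λ (i : Fin 8) → w (inject₁ i))
    lab    : Fin 8 → Fin λ'
    w-adj  : ∀ (i : Fin 8) → adj G (w (inject₁ i)) (w (suc i)) ≡ true

Piece : Graph → ℕ → Set
Piece G λ' = Path8 G λ' ⊎ Cycle8 G λ'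

pieceEdges : {G : Graph} {λ' : ℕ} → Piece G λ' → List (MEdge G λ')
pieceEdges (inj₁ P) = map (λ i → Path8.w P (inject₁ i) , Path8.w P (suc i) , Path8.lab P i) (allFin 8)
pieceEdges (inj₂ C) = map (λ i → Cycle8.w C (inject₁ i) , Cycle8.w C (suc i) , Cycle8.lab C i) (allFin 8)

isPath : {G : Graph} {λ' : ℕ} → Piece G λ' → Bool
isPath (inj₁ _) = true
isPath (inj₂ _) = false

isCycle : {G : Graph} {λ' : ℕ} → Piece G λ' → Bool
isCycle p = not (isPath p)

multiplicity : (G : Graph) (λ' : ℕ) → MEdge G λ' → List (MEdge G λ') → ℕ
multiplicity G λ' e es = length (filterᵇ (sameEdge G λ' e) es)

-- A partition of E(G(λ)) into p copies of P_8 and q copies of C_8: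
-- a list of pieces with exactly p paths and q cycles such that every
-- edge of G(λ) is used exactly once (each piece only uses edges of G(λ)
-- by construction).
Partition8 : (G : Graph) (λ' : ℕ) (p q : ℕ) → Set
Partition8 G λ' p q =
  Σ (List (Piece G λ')) λ ps →
      (length (filterᵇ isPath ps) ≡ p)
    × (length (filterᵇ isCycle ps) ≡ q)
    × (∀ (u v : V G) (k : Fin λ') → adj G u v ≡ true →
         multiplicity G λ' (u , v , k) (concatMap pieceEdges ps) ≡ 1)

Has8Decomposition : (G : Graph) (λ' : ℕ) → Set
Has8Decomposition G λ' =
  Σ ℕ λ p → Σ ℕ λ q → (8 * (p + q) ≡ numMEdges G λ') × Partition8 G λ' p q

-- The group ℤ₃ × ℤ₃ acts on K₃ × K₃ by translations, and its edges fall into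
-- two translation classes of nine edges each: differences ±(1,1) and ±(1,2).
-- An 8-cycle using four edges of each class therefore has nine translates
-- covering every edge exactly four times, once from each of the four base
-- edges of its class.  Labelling the j-th base edge of either class with the
-- parallel copy j makes the nine translates an exact decomposition of
-- (K₃ × K₃)(4) into copies of C₈.
module Submission where

open import Defs
open import Data.Bool using (true; _∧_)
open import Data.Bool.Properties using () renaming (_≟_ to _≟B_)
open import Data.Empty using (⊥-elim)
open import Data.Fin using (Fin; zero; suc; inject₁; fromℕ)
open import Data.Fin.Patterns using (0F; 1F; 2F; 3F)
open import Data.Fin.Properties using (all?) renaming (_≟_ to _≟F_)
open import Data.List using (List; []; _∷_; length; filterᵇ; map; concatMap)
open import Data.List.Membership.Propositional using (_∈_)
open import Data.List.Membership.Propositional.Properties using (∈-allFin; ∈-cartesianProduct⁺)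
import Data.List.Relation.Unary.All as All
open import Data.Nat using (ℕ; suc; _*_) renaming (_≟_ to _≟ℕ_)
open import Data.Product using (_×_; _,_)
open import Data.Product.Properties using (,-injective)
open import Data.Sum using (inj₂)
open import Data.Vec using (Vec; []; _∷_; _∷ʳ_; head; lookup)
open import Function using (_∘_; id)
open import Function.Definitions using (Injective)
open import Relation.Binary.Definitions using (DecidableEquality)
open import Relation.Binary.PropositionalEquality using (_≡_; _≢_; refl; sym; cong; cong₂; module ≡-Reasoning)
open import Relation.Nullary using (Dec; yes; no)
open import Relation.Nullary.Decidable using (True; map′; from-yes; toWitness; _→-dec_)

private
  variable
    A : Set
    n : ℕ

Enumerated : Graph → Set
Enumerated G = ∀ x → x ∈ verts G

K-enumerated : ∀ n → Enumerated (K n)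
K-enumerated n = ∈-allFin

⊗-enumerated : ∀ {G H} → Enumerated G → Enumerated H → Enumerated (G ⊗ H)
⊗-enumerated enumG enumH (x , y) = ∈-cartesianProduct⁺ (enumG x) (enumH y)

∀-vertex? : ∀ G {P : V G → Set} → Enumerated G → (∀ x → Dec (P x)) → Dec (∀ x → P x)
∀-vertex? G enum P? =
  map′ (λ all x → All.lookup all (enum x)) (λ ∀P → All.tabulate (λ {x} _ → ∀P x))
       (All.all? P? (verts G))

injective? : DecidableEquality A → (f : Fin n → A) → Dec (Injective _≡_ _≡_ f)
injective? _≟_ f =
  map′ (λ inj {i} {j} → inj i j) (λ inj i j → inj)
       (all? λ i → all? λ j → (f i ≟ f j) →-dec (i ≟F j))

ExactCover : (G : Graph) (λ' : ℕ) → List (MEdge G λ') → Set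
ExactCover G λ' es =
  ∀ u v (k : Fin λ') → adj G u v ≡ true → multiplicity G λ' (u , v , k) es ≡ 1

exactCover? : ∀ G {λ'} → Enumerated G → (es : List (MEdge G λ')) → Dec (ExactCover G λ' es)
exactCover? G {λ'} enum es =
  ∀-vertex? G enum λ u → ∀-vertex? G enum λ v → all? λ k →
    (adj G u v ≟B true) →-dec (multiplicity G λ' (u , v , k) es ≟ℕ 1)

K-adj⇒≢ : ∀ {i j : Fin n} → adj (K n) i j ≡ true → i ≢ j
K-adj⇒≢ {i = i} {j} i~j with i ≟F j | i~j
... | no i≢j | _ = i≢j

≢⇒K-adj : ∀ {i j : Fin n} → i ≢ j → adj (K n) i j ≡ true
≢⇒K-adj {i = i} {j} i≢j with i ≟F j
... | yes i≡j = ⊥-elim (i≢j i≡j)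
... | no _    = refl

∧-true⁻ : ∀ {a b} → a ∧ b ≡ true → a ≡ true × b ≡ true
∧-true⁻ {true} b≡true = refl , b≡true

∧-true⁺ : ∀ {a b} → a ≡ true → b ≡ true → a ∧ b ≡ true
∧-true⁺ refl b≡true = b≡true

record Embedding (G H : Graph) : Set where
  field
    embed           : V G → V H
    embed-injective : Injective _≡_ _≡_ embed
    embed-adj       : ∀ {x y} → adj G x y ≡ true → adj H (embed x) (embed y) ≡ true

open Embedding

K-embedding : ∀ {m} (f : Fin m → Fin n) → Injective _≡_ _≡_ f → Embedding (K m) (K n)
K-embedding f f-inj = record
  { embed           = f
  ; embed-injective = f-inj
  ; embed-adj       = λ i~j → ≢⇒K-adj (K-adj⇒≢ i~j ∘ f-inj)
  }

⊗-embedding : ∀ {G G′ H H′} → Embedding G G′ → Embedding H H′ → Embedding (G ⊗ H) (G′ ⊗ H′)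
⊗-embedding φ ψ = record
  { embed           = λ (x , y) → embed φ x , embed ψ y
  ; embed-injective = λ eq → let (eq₁ , eq₂) = ,-injective eq in
                        cong₂ _,_ (embed-injective φ eq₁) (embed-injective ψ eq₂)
  ; embed-adj       = λ xy~xy′ → let (x~x′ , y~y′) = ∧-true⁻ xy~xy′ in
                        ∧-true⁺ (embed-adj φ x~x′) (embed-adj ψ y~y′)
  }

Cycle8-map : ∀ {G H λ'} → Embedding G H → Cycle8 G λ' → Cycle8 H λ'
Cycle8-map φ C = record
  { w      = embed φ ∘ w
  ; closed = cong (embed φ) closed
  ; w-inj  = w-inj ∘ embed-injective φ
  ; lab    = lab
  ; w-adj  = embed-adj φ ∘ w-adj
  }
  where open Cycle8 C

closedWalk : Vec A (suc n) → Fin (suc (suc n)) → A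
closedWalk ws = lookup (ws ∷ʳ head ws)

lookup-∷ʳ-inject₁ : ∀ (xs : Vec A n) x i → lookup (xs ∷ʳ x) (inject₁ i) ≡ lookup xs i
lookup-∷ʳ-inject₁ (y ∷ xs) x zero    = refl
lookup-∷ʳ-inject₁ (y ∷ xs) x (suc i) = lookup-∷ʳ-inject₁ xs x i

lookup-∷ʳ-last : ∀ (xs : Vec A n) x → lookup (xs ∷ʳ x) (fromℕ n) ≡ x
lookup-∷ʳ-last []       x = refl
lookup-∷ʳ-last (y ∷ xs) x = lookup-∷ʳ-last xs x

-- The implicit obligations are decisions, so for a concrete vertex list they
-- reduce to ⊤ and are filled in automatically.
cycle8 : ∀ G {λ'} (ws : Vec (V G) 8) (ls : Vec (Fin λ') 8) →
         {True (injective? (_≟V_ G) (lookup ws))} →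
         {True (all? λ i → adj G (closedWalk ws (inject₁ i)) (closedWalk ws (suc i)) ≟B true)} →
         Cycle8 G λ'
cycle8 G ws@(x ∷ _) ls {distinct} {adjacent} = record
  { w      = closedWalk ws
  ; closed = lookup-∷ʳ-last ws x
  ; w-inj  = λ {i} {j} eq → toWitness distinct (begin
      lookup ws i               ≡⟨ sym (lookup-∷ʳ-inject₁ ws x i) ⟩
      closedWalk ws (inject₁ i) ≡⟨ eq ⟩
      closedWalk ws (inject₁ j) ≡⟨ lookup-∷ʳ-inject₁ ws x j ⟩
      lookup ws j               ∎)
  ; lab    = lookup ls
  ; w-adj  = toWitness adjacent
  }
  where open ≡-Reasoning

cycleEdges : ∀ {G λ'} → List (Cycle8 G λ') → List (MEdge G λ')
cycleEdges = concatMap pieceEdges ∘ map inj₂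

paths-map-inj₂ : ∀ {G λ'} (cs : List (Cycle8 G λ')) → length (filterᵇ isPath (map inj₂ cs)) ≡ 0
paths-map-inj₂ []       = refl
paths-map-inj₂ (_ ∷ cs) = paths-map-inj₂ cs

cycles-map-inj₂ : ∀ {G λ'} (cs : List (Cycle8 G λ')) → length (filterᵇ isCycle (map inj₂ cs)) ≡ length cs
cycles-map-inj₂ []       = refl
cycles-map-inj₂ (_ ∷ cs) = cong suc (cycles-map-inj₂ cs)

Has8Decomposition-fromCycles : ∀ {G λ'} (cs : List (Cycle8 G λ')) →
  8 * length cs ≡ numMEdges G λ' → ExactCover G λ' (cycleEdges cs) → Has8Decomposition G λ'
Has8Decomposition-fromCycles cs size cover =
  0 , length cs , size , map inj₂ cs , paths-map-inj₂ cs , cycles-map-inj₂ cs , cover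

rotate : Fin 3 → Fin 3
rotate 0F = 1F
rotate 1F = 2F
rotate 2F = 0F

rotate-injective : Injective _≡_ _≡_ rotate
rotate-injective = from-yes (injective? _≟F_ rotate)

infixl 6 _+₃_
_+₃_ : Fin 3 → Fin 3 → Fin 3
0F +₃ b = b
1F +₃ b = rotate b
2F +₃ b = rotate (rotate b)

+₃-injectiveʳ : ∀ a → Injective _≡_ _≡_ (a +₃_)
+₃-injectiveʳ 0F = id
+₃-injectiveʳ 1F = rotate-injective
+₃-injectiveʳ 2F = rotate-injective ∘ rotate-injective

K₃⊗K₃ : Graph
K₃⊗K₃ = K 3 ⊗ K 3

K₃⊗K₃-enumerated : Enumerated K₃⊗K₃
K₃⊗K₃-enumerated = ⊗-enumerated {K 3} {K 3} (K-enumerated 3) (K-enumerated 3)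

translation : V K₃⊗K₃ → Embedding K₃⊗K₃ K₃⊗K₃
translation (s , t) =
  ⊗-embedding (K-embedding (s +₃_) (+₃-injectiveʳ s)) (K-embedding (t +₃_) (+₃-injectiveʳ t))

-- Its edge differences are, up to sign, (1,2) (1,1) (1,1) (1,2) (1,1) (1,2)
-- (1,1) (1,2), so labelling edge i by ⌊i/2⌋ numbers each class 0,1,2,3.
baseCycle : Cycle8 K₃⊗K₃ 4
baseCycle = cycle8 K₃⊗K₃
  ((0F , 1F) ∷ (1F , 0F) ∷ (0F , 2F) ∷ (2F , 1F) ∷ (1F , 2F) ∷ (2F , 0F) ∷ (1F , 1F) ∷ (2F , 2F) ∷ [])
  (0F ∷ 0F ∷ 1F ∷ 1F ∷ 2F ∷ 2F ∷ 3F ∷ 3F ∷ [])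

translates : List (Cycle8 K₃⊗K₃ 4)
translates = map (λ t → Cycle8-map (translation t) baseCycle) (verts K₃⊗K₃)

mainTheorem14 : Has8Decomposition (K 3 ⊗ K 3) 4
mainTheorem14 = Has8Decomposition-fromCycles translates refl
  (from-yes (exactCover? K₃⊗K₃ K₃⊗K₃-enumerated (cycleEdges translates)))
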